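{- The set of Tarski's axioms (R1)--(R10) is independent. That is, for each $n\in\{1,\dots,10\}$, axiom (R$n$) is not derivable from the other nine axioms: there is an algebra $\mathfrak{A}_n=(A,+,-,;,{}^{\smile},1')$ in which (R$n$) fails and in which (R$m$) is valid for every $m\in\{1,\dots,10\}$ with $m\neq n$.
   Context: All algebras have the form $\mathfrak{A}=(A,+,-,;,{}^{\smile},1')$, where $A$ is a non-empty set, $+$ and $;$ are binary operations on $A$, $-$ and ${}^{\smile}$ are unary operations on $A$, and $1'$ is a distinguished element of $A$. Unary operations bind more tightly than binary ones, and $;$ binds more tightly than $+$. An axiom is valid in $\mathfrak{A}$ if it holds for all elements $r,s,t\in A$; otherwise it fails in $\mathfrak{A}$. Tarski's axioms are: (R1) $r+s=s+r$; (R2) $r+(s+t)=(r+s)+t$; (R3) $-(-r+s)+-(-r+-s)=r$; (R4) $r;(s;t)=(r;s);t$; (R5) $r;1'=r$; (R6) $(r^{\smile})^{\smile}=r$; (R7) $(r;s)^{\smile}=s^{\smile};r^{\smile}$; (R8) $(r+s);t=r;t+s;t$; (R9) $(r+s)^{\smile}=r^{\smile}+s^{\smile}$; (R10) $r^{\smile};-(r;s)+-s=-s$, i.e. $\bigl((r^{\smile});(-(r;s))\bigr)+(-s)=-s$. A set of axioms is independent if none of the axioms in it can be derived from the remaining ones; for each axiom this is witnessed by a model in which that axiom fails and all the remaining axioms are valid. -}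

module Defs where

open import Data.Nat using (ℕ)
open import Data.Product using (∃; _×_)
open import Level using (0ℓ)
open import Relation.Binary.PropositionalEquality using (_≡_; _≢_)
open import Relation.Nullary using (¬_)
open import Relation.Unary using (Pred; _∈_)

-- The symbol ";" is reserved in Agda, so relative multiplication is
-- written "⨾".  Non-emptiness of the carrier is witnessed by 1′.
record Algebra : Set₁ where
  infix  9 _˘
  infix  8 -_
  infixl 7 _⨾_
  infixl 6 _+_
  field
    Carrier : Set
    _+_     : Carrier → Carrier → Carrier
    -_      : Carrier → Carrier
    _⨾_     : Carrier → Carrier → Carrier
    _˘      : Carrier → Carrier
    1′      : Carrier

infix  9 _˘
infix  8 -_
infixl 7 _⨾_
infixl 6 _+_
infix  4 _≈_

data Term : Set where
  var : ℕ → Term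
  _+_ : Term → Term → Term
  -_  : Term → Term
  _⨾_ : Term → Term → Term
  _˘  : Term → Term
  1′  : Term

data Equation : Set where
  _≈_ : Term → Term → Equation

data Axiom : Set where
  R1 R2 R3 R4 R5 R6 R7 R8 R9 R10 : Axiom

private
  r s t : Term
  r = var 0
  s = var 1
  t = var 2

equation : Axiom → Equation
equation R1  = r + s ≈ s + r
equation R2  = r + (s + t) ≈ (r + s) + t
equation R3  = - (- r + s) + - (- r + - s) ≈ r
equation R4  = r ⨾ (s ⨾ t) ≈ (r ⨾ s) ⨾ t
equation R5  = r ⨾ 1′ ≈ r
equation R6  = (r ˘) ˘ ≈ r
equation R7  = (r ⨾ s) ˘ ≈ s ˘ ⨾ r ˘
equation R8  = (r + s) ⨾ t ≈ r ⨾ t + s ⨾ t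
equation R9  = (r + s) ˘ ≈ r ˘ + s ˘
equation R10 = r ˘ ⨾ - (r ⨾ s) + - s ≈ - s

module _ (𝔄 : Algebra) where
  private module A = Algebra 𝔄

  ⟦_⟧ : Term → (ℕ → A.Carrier) → A.Carrier
  ⟦ var i ⟧ ρ = ρ i
  ⟦ a + b ⟧ ρ = ⟦ a ⟧ ρ A.+ ⟦ b ⟧ ρ
  ⟦ - a   ⟧ ρ = A.- ⟦ a ⟧ ρ
  ⟦ a ⨾ b ⟧ ρ = ⟦ a ⟧ ρ A.⨾ ⟦ b ⟧ ρ
  ⟦ a ˘   ⟧ ρ = ⟦ a ⟧ ρ A.˘
  ⟦ 1′    ⟧ ρ = A.1′

  Valid : Equation → Set
  Valid (a ≈ b) = ∀ ρ → ⟦ a ⟧ ρ ≡ ⟦ b ⟧ ρ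

  Fails : Equation → Set
  Fails e = ¬ Valid e

_[_] : Term → (ℕ → Term) → Term
var i   [ σ ] = σ i
(a + b) [ σ ] = (a [ σ ]) + (b [ σ ])
(- a)   [ σ ] = - (a [ σ ])
(a ⨾ b) [ σ ] = (a [ σ ]) ⨾ (b [ σ ])
(a ˘)   [ σ ] = (a [ σ ]) ˘
1′      [ σ ] = 1′

infix 3 _⊢_

-- Derivability in equational logic.
data _⊢_ (Γ : Pred Equation 0ℓ) : Equation → Set where
  hyp    : ∀ {e} → e ∈ Γ → Γ ⊢ e
  refl   : ∀ {a} → Γ ⊢ a ≈ a
  sym    : ∀ {a b} → Γ ⊢ a ≈ b → Γ ⊢ b ≈ a
  trans  : ∀ {a b c} → Γ ⊢ a ≈ b → Γ ⊢ b ≈ c → Γ ⊢ a ≈ c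
  +-cong : ∀ {a b c d} → Γ ⊢ a ≈ b → Γ ⊢ c ≈ d → Γ ⊢ a + c ≈ b + d
  -‿cong : ∀ {a b} → Γ ⊢ a ≈ b → Γ ⊢ - a ≈ - b
  ⨾-cong : ∀ {a b c d} → Γ ⊢ a ≈ b → Γ ⊢ c ≈ d → Γ ⊢ a ⨾ c ≈ b ⨾ d
  ˘-cong : ∀ {a b} → Γ ⊢ a ≈ b → Γ ⊢ a ˘ ≈ b ˘
  inst   : ∀ {a b} (σ : ℕ → Term) → Γ ⊢ a ≈ b → Γ ⊢ a [ σ ] ≈ b [ σ ]

Remaining : Axiom → Pred Equation 0ℓ
Remaining n e = ∃ λ m → m ≢ n × e ≡ equation m

{-# OPTIONS --safe #-}
module Submission where

open import Defs
open import Data.Bool using (Bool; true; false; _∧_; _∨_; _xor_; not; if_then_else_)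
open import Data.Fin using (Fin; zero; suc)
open import Data.Fin.Properties using (all?) renaming (_≟_ to _≟ᶠ_)
open import Data.Nat using (ℕ)
open import Data.Product using (_×_; Σ-syntax; _,_; proj₁; proj₂)
open import Data.Product.Properties using (≡-dec)
open import Function using (id; const; _∘_)
open import Relation.Binary.Definitions using (DecidableEquality)
open import Relation.Binary.PropositionalEquality as ≡ using (_≡_; _≢_; refl; cong; cong₂; subst)
open import Relation.Nullary using (¬_; Dec)
open import Relation.Nullary.Decidable using (map′; ¬?; _×-dec_; _→-dec_; toWitness)
open import Relation.Unary using (Pred; Decidable; _∈_)
import Data.Bool.Properties as Bool

-- Each axiom is separated from the others by a finite model of at most
-- eight elements, and soundness of equational logic turns the model into
-- an underivability result.  The two-element Boolean algebra with degenerate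
-- relative operations suffices for (R5), (R6), (R8) and (R10).  The models for (R7)
-- and (R9) owe their existence to the fact that monotonicity of ⨾ in its
-- second argument is not among the axioms: it follows from (R6)–(R9).

private
  variable
    A B : Set

-- Soundness of equational logic.

⟦[]⟧ : ∀ 𝔄 a σ ρ → ⟦ 𝔄 ⟧ (a [ σ ]) ρ ≡ ⟦ 𝔄 ⟧ a (λ i → ⟦ 𝔄 ⟧ (σ i) ρ)
⟦[]⟧ 𝔄 (var i) σ ρ = refl
⟦[]⟧ 𝔄 (a + b) σ ρ = cong₂ (Algebra._+_ 𝔄) (⟦[]⟧ 𝔄 a σ ρ) (⟦[]⟧ 𝔄 b σ ρ)
⟦[]⟧ 𝔄 (- a)   σ ρ = cong (Algebra.-_ 𝔄) (⟦[]⟧ 𝔄 a σ ρ)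
⟦[]⟧ 𝔄 (a ⨾ b) σ ρ = cong₂ (Algebra._⨾_ 𝔄) (⟦[]⟧ 𝔄 a σ ρ) (⟦[]⟧ 𝔄 b σ ρ)
⟦[]⟧ 𝔄 (a ˘)   σ ρ = cong (Algebra._˘ 𝔄) (⟦[]⟧ 𝔄 a σ ρ)
⟦[]⟧ 𝔄 1′      σ ρ = refl

soundness : ∀ 𝔄 {Γ e} → (∀ {e′} → e′ ∈ Γ → Valid 𝔄 e′) → Γ ⊢ e → Valid 𝔄 e
soundness 𝔄 Γ-valid (hyp e∈Γ)    = Γ-valid e∈Γ
soundness 𝔄 Γ-valid refl         ρ = refl
soundness 𝔄 Γ-valid (sym d)      ρ = ≡.sym (soundness 𝔄 Γ-valid d ρ)
soundness 𝔄 Γ-valid (trans d d′) ρ =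
  ≡.trans (soundness 𝔄 Γ-valid d ρ) (soundness 𝔄 Γ-valid d′ ρ)
soundness 𝔄 Γ-valid (+-cong d d′) ρ =
  cong₂ (Algebra._+_ 𝔄) (soundness 𝔄 Γ-valid d ρ) (soundness 𝔄 Γ-valid d′ ρ)
soundness 𝔄 Γ-valid (-‿cong d)   ρ = cong (Algebra.-_ 𝔄) (soundness 𝔄 Γ-valid d ρ)
soundness 𝔄 Γ-valid (⨾-cong d d′) ρ =
  cong₂ (Algebra._⨾_ 𝔄) (soundness 𝔄 Γ-valid d ρ) (soundness 𝔄 Γ-valid d′ ρ)
soundness 𝔄 Γ-valid (˘-cong d)   ρ = cong (Algebra._˘ 𝔄) (soundness 𝔄 Γ-valid d ρ)
-- The valuation left implicit sends `i` to the value of `σ i` at `ρ`.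
soundness 𝔄 Γ-valid (inst {a} {b} σ d) ρ =
  ≡.trans (⟦[]⟧ 𝔄 a σ ρ) (≡.trans (soundness 𝔄 Γ-valid d _) (≡.sym (⟦[]⟧ 𝔄 b σ ρ)))

Separates : Algebra → Axiom → Set
Separates 𝔄 n = Fails 𝔄 (equation n) × (∀ m → m ≢ n → Valid 𝔄 (equation m))

underivable : ∀ {𝔄 n} → Separates 𝔄 n → ¬ (Remaining n ⊢ equation n)
underivable {𝔄} (fails , valid) d =
  fails (soundness 𝔄 (λ { (m , m≢n , refl) → valid m m≢n }) d)

-- Decidable quantification over finite types.

record Finite (A : Set) : Set₁ where
  field
    _≟_ : DecidableEquality A
    ∀?  : ∀ {P : Pred A _} → Decidable P → Dec (∀ x → P x)

open Finite {{...}}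

instance
  Bool-finite : Finite Bool
  Bool-finite = record
    { _≟_ = Bool._≟_
    ; ∀?  = λ P? → map′ (λ { (f , t) false → f ; (f , t) true → t })
                        (λ all → all false , all true)
                        (P? false ×-dec P? true)
    }

  Fin-finite : ∀ {n} → Finite (Fin n)
  Fin-finite = record { _≟_ = _≟ᶠ_ ; ∀? = all? }

  ×-finite : {{Finite A}} → {{Finite B}} → Finite (A × B)
  ×-finite = record
    { _≟_ = ≡-dec _≟_ _≟_
    ; ∀?  = λ P? → map′ (λ all (x , y) → all x y) (λ all x y → all (x , y))
                        (∀? λ x → ∀? λ y → P? (x , y))
    }

retract-finite : {{Finite A}} → (f : A → B) (g : B → A) → (∀ y → f (g y) ≡ y) → Finite B
retract-finite f g fg = record
  { _≟_ = λ x y → map′ (λ eq → ≡.trans (≡.sym (fg x)) (≡.trans (cong f eq) (fg y))) (cong g)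
                       (g x ≟ g y)
  ; ∀?  = λ {P} P? → map′ (λ all y → subst P (fg y) (all (g y))) (_∘ f) (∀? (P? ∘ f))
  }

instance
  Axiom-finite : Finite Axiom
  Axiom-finite = retract-finite axiom index axiom-index
    where
    axiom : Fin 10 → Axiom
    axiom zero = R1
    axiom (suc zero) = R2
    axiom (suc (suc zero)) = R3
    axiom (suc (suc (suc zero))) = R4
    axiom (suc (suc (suc (suc zero)))) = R5
    axiom (suc (suc (suc (suc (suc zero))))) = R6
    axiom (suc (suc (suc (suc (suc (suc zero)))))) = R7
    axiom (suc (suc (suc (suc (suc (suc (suc zero))))))) = R8
    axiom (suc (suc (suc (suc (suc (suc (suc (suc zero)))))))) = R9
    axiom (suc (suc (suc (suc (suc (suc (suc (suc (suc zero))))))))) = R10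

    index : Axiom → Fin 10
    index R1  = zero
    index R2  = suc zero
    index R3  = suc (suc zero)
    index R4  = suc (suc (suc zero))
    index R5  = suc (suc (suc (suc zero)))
    index R6  = suc (suc (suc (suc (suc zero))))
    index R7  = suc (suc (suc (suc (suc (suc zero)))))
    index R8  = suc (suc (suc (suc (suc (suc (suc zero))))))
    index R9  = suc (suc (suc (suc (suc (suc (suc (suc zero)))))))
    index R10 = suc (suc (suc (suc (suc (suc (suc (suc (suc zero))))))))

    axiom-index : ∀ n → axiom (index n) ≡ n
    axiom-index R1  = refl
    axiom-index R2  = refl
    axiom-index R3  = refl
    axiom-index R4  = refl
    axiom-index R5  = refl
    axiom-index R6  = refl
    axiom-index R7  = refl
    axiom-index R8  = refl
    axiom-index R9  = refl
    axiom-index R10 = refl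

-- Deciding validity in a finite algebra.

HoldsAt : ∀ 𝔄 → Equation → (ℕ → Algebra.Carrier 𝔄) → Set
HoldsAt 𝔄 (a ≈ b) ρ = ⟦ 𝔄 ⟧ a ρ ≡ ⟦ 𝔄 ⟧ b ρ

holdsAt? : ∀ 𝔄 → {{Finite (Algebra.Carrier 𝔄)}} → ∀ e ρ → Dec (HoldsAt 𝔄 e ρ)
holdsAt? 𝔄 (a ≈ b) ρ = ⟦ 𝔄 ⟧ a ρ ≟ ⟦ 𝔄 ⟧ b ρ

assign : A → A → A → ℕ → A
assign x y z 0 = x
assign x y z 1 = y
assign x y z _ = z

module _ (𝔄 : Algebra) where
  private
    Valid₃ : Axiom → Set
    Valid₃ n = ∀ x y z → HoldsAt 𝔄 (equation n) (assign x y z)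

  -- Only variables 0, 1 and 2 occur in the axioms, so for each constructor `n` the values at `ρ`
  -- and at `assign (ρ 0) (ρ 1) (ρ 2)` agree by computation.
  valid₃⇒valid : ∀ n → Valid₃ n → Valid 𝔄 (equation n)
  valid₃⇒valid R1  v ρ = v (ρ 0) (ρ 1) (ρ 2)
  valid₃⇒valid R2  v ρ = v (ρ 0) (ρ 1) (ρ 2)
  valid₃⇒valid R3  v ρ = v (ρ 0) (ρ 1) (ρ 2)
  valid₃⇒valid R4  v ρ = v (ρ 0) (ρ 1) (ρ 2)
  valid₃⇒valid R5  v ρ = v (ρ 0) (ρ 1) (ρ 2)
  valid₃⇒valid R6  v ρ = v (ρ 0) (ρ 1) (ρ 2)
  valid₃⇒valid R7  v ρ = v (ρ 0) (ρ 1) (ρ 2)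
  valid₃⇒valid R8  v ρ = v (ρ 0) (ρ 1) (ρ 2)
  valid₃⇒valid R9  v ρ = v (ρ 0) (ρ 1) (ρ 2)
  valid₃⇒valid R10 v ρ = v (ρ 0) (ρ 1) (ρ 2)

  valid⇒valid₃ : ∀ n → Valid 𝔄 (equation n) → Valid₃ n
  valid⇒valid₃ n v x y z = holds (equation n) v (assign x y z)
    where
    holds : ∀ e → Valid 𝔄 e → ∀ ρ → HoldsAt 𝔄 e ρ
    holds (a ≈ b) v = v

  module _ {{_ : Finite (Algebra.Carrier 𝔄)}} where
    valid? : ∀ n → Dec (Valid 𝔄 (equation n))
    valid? n = map′ (valid₃⇒valid n) (valid⇒valid₃ n)
      (∀? λ x → ∀? λ y → ∀? λ z → holdsAt? 𝔄 (equation n) (assign x y z))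

    separates? : ∀ n → Dec (Separates 𝔄 n)
    separates? n = ¬? (valid? n) ×-dec ∀? λ m → ¬? (m ≟ n) →-dec valid? m

-- The ten separating models.

pattern 0ᵗ = zero
pattern 1ᵗ = suc zero
pattern 2ᵗ = suc (suc zero)

-- With + a projection and - the identity, (R10) reads r˘ ⨾ (r ⨾ s) = s, which
-- holds in every group.
𝔄₁ : Algebra
𝔄₁ = record
  { Carrier = Bool ; _+_ = const ; -_ = id ; _⨾_ = _xor_ ; _˘ = id ; 1′ = false }

-- The integers modulo 3 as the signs 0, 1, -1, with their usual negation and
-- product, and + changed to be idempotent.
𝔄₂ : Algebra
𝔄₂ = record
  { Carrier = Fin 3 ; _+_ = _⊕_ ; -_ = ⊖_ ; _⨾_ = _⊗_ ; _˘ = id ; 1′ = 1ᵗ }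
  where
  _⊕_ : Fin 3 → Fin 3 → Fin 3
  0ᵗ ⊕ y  = y
  x  ⊕ 0ᵗ = x
  1ᵗ ⊕ 1ᵗ = 1ᵗ
  2ᵗ ⊕ 2ᵗ = 2ᵗ
  1ᵗ ⊕ 2ᵗ = 0ᵗ
  2ᵗ ⊕ 1ᵗ = 0ᵗ

  ⊖_ : Fin 3 → Fin 3
  ⊖ 0ᵗ = 0ᵗ
  ⊖ 1ᵗ = 2ᵗ
  ⊖ 2ᵗ = 1ᵗ

  _⊗_ : Fin 3 → Fin 3 → Fin 3
  0ᵗ ⊗ y = 0ᵗ
  1ᵗ ⊗ y = y
  2ᵗ ⊗ y = ⊖ y

-- With - the identity, (R10) is the absorption law (r ∧ (r ∧ s)) ∨ s = s, while (R3) would say r ∨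
-- s = r.
𝔄₃ : Algebra
𝔄₃ = record
  { Carrier = Bool ; _+_ = _∨_ ; -_ = id ; _⨾_ = _∧_ ; _˘ = id ; 1′ = true }

-- The triple (e , a , b) stands for the subset of a three-element set of atoms
-- whose characteristic function takes these values.
Subset₃ : Set
Subset₃ = Bool × Bool × Bool

_∪_ : Subset₃ → Subset₃ → Subset₃
(e , a , b) ∪ (e′ , a′ , b′) = e ∨ e′ , a ∨ a′ , b ∨ b′

∁ : Subset₃ → Subset₃
∁ (e , a , b) = not e , not a , not b

-- The complex algebra of the partial operation on {e, a, b} with identity e,
-- a² = b² = e and ab, ba undefined, so that (aa)b = b while a(ab) = ∅.
𝔄₄ : Algebra
𝔄₄ = record
  { Carrier = Subset₃ ; _+_ = _∪_ ; -_ = ∁ ; _⨾_ = _·_ ; _˘ = id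
  ; 1′ = true , false , false }
  where
  _·_ : Subset₃ → Subset₃ → Subset₃
  (e , a , b) · (e′ , a′ , b′) =
    (e ∧ e′) ∨ (a ∧ a′) ∨ (b ∧ b′) , (e ∧ a′) ∨ (a ∧ e′) , (e ∧ b′) ∨ (b ∧ e′)

𝔄₅ : Algebra
𝔄₅ = record
  { Carrier = Bool ; _+_ = _∨_ ; -_ = not ; _⨾_ = λ _ _ → false ; _˘ = id ; 1′ = true }

𝔄₆ : Algebra
𝔄₆ = record
  { Carrier = Bool ; _+_ = _∨_ ; -_ = not ; _⨾_ = _∧_ ; _˘ = const false ; 1′ = true }

-- Only the atom 1′ multiplies nontrivially on the right, so ⨾ is not monotone
-- in its second argument.
𝔄₇ : Algebra
𝔄₇ = record
  { Carrier = Bool × Bool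
  ; _+_ = λ (a , b) (a′ , b′) → a ∨ a′ , b ∨ b′
  ; -_  = λ (a , b) → not a , not b
  ; _⨾_ = λ { r (true , false) → r ; r _ → false , false }
  ; _˘  = id
  ; 1′  = true , false
  }

-- Since `not` commutes with `_xor_`, r ⨾ - (r ⨾ s) = - s, which gives (R10). But `_xor_` is not
-- monotone, so (R8) fails.
𝔄₈ : Algebra
𝔄₈ = record
  { Carrier = Bool ; _+_ = _∨_ ; -_ = not ; _⨾_ = _xor_ ; _˘ = id ; 1′ = false }

-- The atoms are the elements 0, 1, 2 of ℤ/3.  An atom i acts on sets with at
-- most one element as the rotation by i and on larger sets as the rotation by
-- -i, and r ⨾ s is the union of the images of s under the atoms in r.  Since
-- i ⨾ - {j} = - {j - i}, complementing i ⨾ s and multiplying by i again returns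
-- to - s; so (R10) holds with ˘ fixing the atoms, while (R7) forces ˘ to act as
-- j ↦ - j on larger sets.
𝔄₉ : Algebra
𝔄₉ = record
  { Carrier = Subset₃ ; _+_ = _∪_ ; -_ = ∁ ; _⨾_ = _·_ ; _˘ = conv
  ; 1′ = true , false , false }
  where
  large : Subset₃ → Bool
  large (x , y , z) = (x ∧ y) ∨ (y ∧ z) ∨ (z ∧ x)

  rot¹ rot² conv : Subset₃ → Subset₃
  rot¹ (x , y , z) = z , x , y
  rot² (x , y , z) = y , z , x
  conv s@(x , y , z) = if large s then (x , z , y) else s

  _∩_ : Bool → Subset₃ → Subset₃
  b ∩ s = if b then s else (false , false , false)

  _·_ : Subset₃ → Subset₃ → Subset₃
  (x , y , z) · s = (x ∩ s) ∪ ((y ∩ (if large s then rot² s else rot¹ s))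
                             ∪ (z ∩ (if large s then rot¹ s else rot² s)))

𝔄₁₀ : Algebra
𝔄₁₀ = record
  { Carrier = Bool ; _+_ = _∨_ ; -_ = not ; _⨾_ = _∨_ ; _˘ = id ; 1′ = false }

independent : ∀ n → Σ[ 𝔄 ∈ Algebra ] Separates 𝔄 n
-- Type checking evaluates `separates?`; `_` is the unit value that remains when the answer is yes.
independent R1  = 𝔄₁  , toWitness {a? = separates? 𝔄₁  R1} _
independent R2  = 𝔄₂  , toWitness {a? = separates? 𝔄₂  R2} _
independent R3  = 𝔄₃  , toWitness {a? = separates? 𝔄₃  R3} _
independent R4  = 𝔄₄  , toWitness {a? = separates? 𝔄₄  R4} _
independent R5  = 𝔄₅  , toWitness {a? = separates? 𝔄₅  R5} _
independent R6  = 𝔄₆  , toWitness {a? = separates? 𝔄₆  R6} _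
independent R7  = 𝔄₇  , toWitness {a? = separates? 𝔄₇  R7} _
independent R8  = 𝔄₈  , toWitness {a? = separates? 𝔄₈  R8} _
independent R9  = 𝔄₉  , toWitness {a? = separates? 𝔄₉  R9} _
independent R10 = 𝔄₁₀ , toWitness {a? = separates? 𝔄₁₀ R10} _

theorem1 : (∀ (n : Axiom) → ¬ (Remaining n ⊢ equation n))
    × (∀ (n : Axiom) → Σ[ 𝔄 ∈ Algebra ] (Fails 𝔄 (equation n) × (∀ (m : Axiom) → m ≢ n → Valid 𝔄 (equation m))))
theorem1 = (λ n → underivable (proj₂ (independent n))) , independent
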